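{- Let $q$ be a prime power, let $f(X)=X^2+bX+c$ be an irreducible quadratic polynomial over $\mathbb F_q$, and let $\{U_n\}_{n\ge0}$ be the Lucas sequence of the first type associated to $f(X)$. Assume that $r\ge1$ is the smallest positive integer such that $U_r=0$. Then the binomial order of $f(X)$ is $r$ and the minimal binomial multiple of $f(X)$ is $X^r+cU_{r-1}$.
   Context: The Lucas sequence of the first type associated to $f(X)=X^2+bX+c$ is defined by $U_0=0$, $U_1=1$, and $U_n=-bU_{n-1}-cU_{n-2}$ for $n\ge2$ (elements of $\mathbb F_q$). For a nonconstant monic polynomial $f\in\mathbb F_q[X]$ with nonzero constant term, the minimal binomial multiple of $f$ is the monic binomial $X^r-\lambda\in\mathbb F_q[X]$ (with $\lambda\neq0$) of lowest degree among the binomials over $\mathbb F_q$ divisible by $f$; its degree $r$ is the binomial order of $f$. -}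

module Defs where

open import Algebra.Apartness.Bundles using (HeytingField)
open import Algebra.Bundles.Raw using (RawRing)
open import Data.Fin.Base using (Fin)
open import Data.List.Base using (List; []; _∷_; map)
open import Data.Nat.Base as ℕ using (ℕ; zero; suc; _≤_)
open import Data.Nat.Primality using (Prime)
open import Data.Product.Base using (_×_; ∃; ∃₂)
open import Function.Bundles using (Inverse)
open import Level using (Level; _⊔_)
open import Relation.Binary.PropositionalEquality using (_≡_; setoid)
open import Relation.Nullary.Negation using (¬_)
import Algebra.Definitions.RawSemiring as RawSemiringDefinitions

IsPrimePower : ℕ → Set
IsPrimePower q = ∃₂ λ p k → Prime p × 1 ≤ k × q ≡ p ℕ.^ k

IsLeast : ∀ {a : Level} → (ℕ → Set a) → ℕ → Set a
IsLeast P n = P n × (∀ m → P m → n ≤ m)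

-- In a HeytingField, x # y is equivalent to invertibility of x - y, and
-- tightness makes 0# the only element not apart from 0#.  When the carrier is
-- finite this is an ordinary field, and x # y is equivalent to ¬ (x ≈ y).
HasOrder : ∀ {a ℓ₁ ℓ₂ : Level} → HeytingField a ℓ₁ ℓ₂ → ℕ → Set (a ⊔ ℓ₁)
HasOrder F q = Inverse (setoid (Fin q)) (HeytingField.setoid F)

module Polynomials {a ℓ₁ ℓ₂ : Level} (F : HeytingField a ℓ₁ ℓ₂) where

  open HeytingField F

  -- Coefficients in order of increasing degree.  Trailing zeros are allowed,
  -- so polynomials are compared by _≈ₚ_ and not by propositional equality.
  Poly : Set a
  Poly = List Carrier

  coeff : Poly → ℕ → Carrier
  coeff []      n       = 0#
  coeff (x ∷ f) zero    = x
  coeff (x ∷ f) (suc n) = coeff f n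

  infix  4 _≈ₚ_
  infixl 6 _+ₚ_ _-ₚ_
  infixl 7 _*ₚ_

  _≈ₚ_ : Poly → Poly → Set ℓ₁
  f ≈ₚ g = ∀ n → coeff f n ≈ coeff g n

  _+ₚ_ : Poly → Poly → Poly
  []      +ₚ g       = g
  (x ∷ f) +ₚ []      = x ∷ f
  (x ∷ f) +ₚ (y ∷ g) = (x + y) ∷ (f +ₚ g)

  _*ₚ_ : Poly → Poly → Poly
  []      *ₚ g = []
  (x ∷ f) *ₚ g = map (x *_) g +ₚ (0# ∷ (f *ₚ g))

  const : Carrier → Poly
  const x = x ∷ []

  X : Poly
  X = 0# ∷ 1# ∷ []

  polyRawRing : RawRing a ℓ₁
  polyRawRing = record
    { Carrier = Poly
    ; _≈_     = _≈ₚ_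
    ; _+_     = _+ₚ_
    ; _*_     = _*ₚ_
    ; -_      = map (-_)
    ; 0#      = []
    ; 1#      = const 1#
    }

  _-ₚ_ : Poly → Poly → Poly
  f -ₚ g = f +ₚ map (-_) g

  open RawSemiringDefinitions (RawRing.rawSemiring polyRawRing) public
    using (Irreducible)
    renaming (_^_ to _^ₚ_; _∣_ to _∣ₚ_)

  -- The condition 1 ≤ r excludes the constants X⁰ - x; in particular it
  -- excludes X⁰ - 1 = 0, which every polynomial divides.
  IsBinomial : ℕ → Poly → Set (a ⊔ ℓ₁)
  IsBinomial r g = 1 ≤ r × ∃ λ x → ¬ (x ≈ 0#) × g ≈ₚ X ^ₚ r -ₚ const x

  record IsMinimalBinomialMultipleOfDegree (f : Poly) (r : ℕ) (g : Poly)
         : Set (a ⊔ ℓ₁) where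
    field
      binomial : IsBinomial r g
      multiple : f ∣ₚ g
      minimal  : ∀ s h → IsBinomial s h → f ∣ₚ h → r ≤ s
      unique   : ∀ h → IsBinomial r h → f ∣ₚ h → h ≈ₚ g

  IsMinimalBinomialMultiple : Poly → Poly → Set (a ⊔ ℓ₁)
  IsMinimalBinomialMultiple f g =
    ∃ λ r → IsMinimalBinomialMultipleOfDegree f r g

  IsBinomialOrder : Poly → ℕ → Set (a ⊔ ℓ₁)
  IsBinomialOrder f r = ∃ λ g → IsMinimalBinomialMultipleOfDegree f r g

  lucasU : Carrier → Carrier → ℕ → Carrier
  lucasU b c zero          = 0#
  lucasU b c (suc zero)    = 1#
  lucasU b c (suc (suc n)) =
    (- b) * lucasU b c (suc n) + (- (c * lucasU b c n))

{-# OPTIONS --safe #-}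

-- Modulo f, every polynomial is congruent to a unique lo + hi X, which Horner's
-- scheme computes from X² ≡ - b X - c, and f ∣ g exactly when lo and hi vanish
-- at g.  Since X ^ (n + 1) ≡ U (n + 1) X - c U n, f divides X ^ (n + 1) - x
-- exactly when U (n + 1) = 0 and x = - c U n.
module Submission where

open import Defs
open import Algebra.Apartness.Bundles using (HeytingField; HeytingCommutativeRing)
open import Algebra.Bundles using (CommutativeRing)
open import Algebra.Bundles.Raw using (RawRing)
open import Data.List.Base using ([]; _∷_; map)
open import Data.Nat.Base using (ℕ; zero; suc; _≤_; _∸_; z≤n; s≤s)
open import Data.Nat.Properties using (1+n≰n)
open import Data.Product.Base using (_×_; _,_; proj₁; proj₂)
open import Data.Sum.Base using ([_,_]′)
open import Level using (Level)
open import Relation.Nullary.Negation using (¬_)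
import Algebra.Apartness.Properties.HeytingCommutativeRing as HeytingProperties
import Algebra.Definitions.RawMagma as RawMagmaDefinitions
import Algebra.Definitions.RawSemiring as RawSemiringDefinitions
import Algebra.Properties.Ring as RingProperties
import Algebra.Solver.Ring.NaturalCoefficients.Default as Solver
import Relation.Binary.Reasoning.Setoid as SetoidReasoning

module PolynomialLemmas {a ℓ₁ ℓ₂ : Level} (F : HeytingField a ℓ₁ ℓ₂) where

  open HeytingField F
  open Polynomials F
  open HeytingCommutativeRing heytingCommutativeRing using (commutativeRing)
  open CommutativeRing commutativeRing using (ring; commutativeSemiring)
  open HeytingProperties heytingCommutativeRing using (1#0; x-0≈x)
  open RingProperties ring using (-0#≈0#; -‿distribˡ-*; -‿involutive; +-inverseʳ-unique)
  open RawMagmaDefinitions (RawRing.*-rawMagma polyRawRing) using (_,_)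
  open Solver commutativeSemiring
  open SetoidReasoning setoid

  -- Nonzero elements of a Heyting field

  1≉0 : ¬ 1# ≈ 0#
  1≉0 1≈0 = proj₂ (tight 1# 0#) 1≈0 1#0

  -- Tightness reduces `x ≈ 0#` to refuting `x # 0#`, and apartness supplies an `x⁻¹` that cancels
  -- `x` from `x * y ≈ 0#`.
  *-≉0 : ∀ {x y} → ¬ x ≈ 0# → ¬ y ≈ 0# → ¬ x * y ≈ 0#
  *-≉0 {x} {y} x≉0 y≉0 xy≈0 = x≉0 (proj₁ (tight x 0#) ¬x#0)
    where
    ¬x#0 : ¬ x # 0#
    ¬x#0 x#0 = let (x⁻¹ , x⁻¹*x≈1 , _) = #⇒invertible x#0 in y≉0 (begin
      y                     ≈⟨ *-identityˡ y ⟨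
      1# * y                ≈⟨ *-congʳ x⁻¹*x≈1 ⟨
      x⁻¹ * (x - 0#) * y    ≈⟨ *-congʳ (*-congˡ (x-0≈x x)) ⟩
      x⁻¹ * x * y           ≈⟨ *-assoc x⁻¹ x y ⟩
      x⁻¹ * (x * y)         ≈⟨ *-congˡ xy≈0 ⟩
      x⁻¹ * 0#              ≈⟨ zeroʳ x⁻¹ ⟩
      0#                    ∎)

  -- Coefficients of sums, scalings and shifts

  coeff-+ : ∀ f g n → coeff (f +ₚ g) n ≈ coeff f n + coeff g n
  coeff-+ []      g       n       = sym (+-identityˡ _)
  coeff-+ (x ∷ f) []      n       = sym (+-identityʳ _)
  coeff-+ (x ∷ f) (y ∷ g) zero    = refl
  coeff-+ (x ∷ f) (y ∷ g) (suc n) = coeff-+ f g n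

  coeff-scale : ∀ k f n → coeff (map (k *_) f) n ≈ k * coeff f n
  coeff-scale k []      n       = sym (zeroʳ k)
  coeff-scale k (x ∷ f) zero    = refl
  coeff-scale k (x ∷ f) (suc n) = coeff-scale k f n

  ∷-cong : ∀ {x y f g} → x ≈ y → f ≈ₚ g → x ∷ f ≈ₚ y ∷ g
  ∷-cong x≈y f≈g zero    = x≈y
  ∷-cong x≈y f≈g (suc n) = f≈g n

  +ₚ-congʳ : ∀ {f g} h → f ≈ₚ g → f +ₚ h ≈ₚ g +ₚ h
  +ₚ-congʳ {f} {g} h f≈g n = begin
    coeff (f +ₚ h) n          ≈⟨ coeff-+ f h n ⟩
    coeff f n + coeff h n     ≈⟨ +-congʳ (f≈g n) ⟩
    coeff g n + coeff h n     ≈⟨ coeff-+ g h n ⟨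
    coeff (g +ₚ h) n          ∎

  +ₚ-const-cong : ∀ f {x y} → x ≈ y → f +ₚ const x ≈ₚ f +ₚ const y
  +ₚ-const-cong []      x≈y zero    = x≈y
  +ₚ-const-cong []      x≈y (suc n) = refl
  +ₚ-const-cong (z ∷ f) x≈y zero    = +-congˡ x≈y
  +ₚ-const-cong (z ∷ f) x≈y (suc n) = refl

  -- Besides the shifted `g`, unfolding the product leaves `0 g` and a final zero from the empty
  -- tail of `X`. Both contribute nothing to any coefficient.
  X*≈ : ∀ g → X *ₚ g ≈ₚ 0# ∷ g
  X*≈ g n = begin
    coeff (map (0# *_) g +ₚ (0# ∷ (map (1# *_) g +ₚ (0# ∷ [])))) n
      ≈⟨ coeff-+ (map (0# *_) g) _ n ⟩
    coeff (map (0# *_) g) n + coeff (0# ∷ (map (1# *_) g +ₚ (0# ∷ []))) n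
      ≈⟨ +-cong (trans (coeff-scale 0# g n) (zeroˡ _)) (∷-cong {f = map (1# *_) g +ₚ (0# ∷ [])} refl 1*g+0≈g n) ⟩
    0# + coeff (0# ∷ g) n
      ≈⟨ +-identityˡ _ ⟩
    coeff (0# ∷ g) n
      ∎
    where
    0∷[]≈[] : 0# ∷ [] ≈ₚ []
    0∷[]≈[] zero    = refl
    0∷[]≈[] (suc n) = refl

    1*g+0≈g : map (1# *_) g +ₚ (0# ∷ []) ≈ₚ g
    1*g+0≈g n = begin
      coeff (map (1# *_) g +ₚ (0# ∷ [])) n          ≈⟨ coeff-+ (map (1# *_) g) _ n ⟩
      coeff (map (1# *_) g) n + coeff (0# ∷ []) n   ≈⟨ +-cong (coeff-scale 1# g n) (0∷[]≈[] n) ⟩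
      1# * coeff g n + 0#                           ≈⟨ +-identityʳ _ ⟩
      1# * coeff g n                                ≈⟨ *-identityˡ _ ⟩
      coeff g n                                     ∎

  -- Every multiple of `X` has constant coefficient zero.
  X∤1 : ¬ X ∣ₚ const 1#
  X∤1 (q , qX≈1) = 1≉0 (trans (sym (qX≈1 0)) (coeff₀ q))
    where
    coeff₀ : ∀ q → coeff (q *ₚ X) 0 ≈ 0#
    coeff₀ []      = refl
    coeff₀ (x ∷ q) = trans (+-identityʳ _) (zeroʳ x)

  -- The monic quadratic and remainders modulo it

  module MonicQuadratic (b c : Carrier) where

    quadratic : Poly
    quadratic = c ∷ b ∷ 1# ∷ []

    -- The left side does not reduce to the list `quadratic`. The divisibility results below
    -- therefore speak of any `f` with `f ≈ₚ quadratic`.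
    X²+bX+c≈quadratic : X ^ₚ 2 +ₚ const b *ₚ X +ₚ const c ≈ₚ quadratic
    X²+bX+c≈quadratic n = trans
      (+ₚ-congʳ {X ^ₚ 2 +ₚ const b *ₚ X} {g +ₚ const b *ₚ X} (const c)
        (+ₚ-congʳ {X ^ₚ 2} {g} (const b *ₚ X) X²≈g) n)
      (coeffs n)
      where
      g : Poly
      g = 0# ∷ 0# ∷ 1# ∷ []

      X²≈g : X ^ₚ 2 ≈ₚ g
      X²≈g n = trans (X*≈ (X ^ₚ 1) n) (∷-cong {f = X ^ₚ 1} {X} refl (X*≈ (const 1#)) n)

      coeffs : g +ₚ const b *ₚ X +ₚ const c ≈ₚ quadratic
      coeffs 0 = solve 2 (λ b c → con 0 :+ (b :* con 0 :+ con 0) :+ c := c) refl b c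
      coeffs 1 = solve 1 (λ b → con 0 :+ b :* con 1 := b) refl b
      coeffs 2 = refl
      coeffs (suc (suc (suc n))) = refl

    -- If `g ≡ lo g + hi g X`, then `X g ≡ lo g X + hi g X²`. Replacing `X²` by `- b X - c` gives
    -- the two recursive clauses.
    lo hi : Poly → Carrier
    lo []      = 0#
    lo (x ∷ g) = x + - c * hi g
    hi []      = 0#
    hi (x ∷ g) = - b * hi g + lo g

    -- This turns out to be the ideal generated by the quadratic. As a record, its type determines
    -- `g`, which the two equations in the field would not.
    record Vanishes (g : Poly) : Set ℓ₁ where
      constructor _,_
      field
        lo≈0 : lo g ≈ 0#
        hi≈0 : hi g ≈ 0#

    open Vanishes

    lo-+ : ∀ f g → lo (f +ₚ g) ≈ lo f + lo g
    hi-+ : ∀ f g → hi (f +ₚ g) ≈ hi f + hi g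
    lo-+ []      g       = sym (+-identityˡ _)
    lo-+ (x ∷ f) []      = sym (+-identityʳ _)
    lo-+ (x ∷ f) (y ∷ g) = trans (+-congˡ (*-congˡ (hi-+ f g)))
      (solve 5 (λ x y γ u v → x :+ y :+ γ :* (u :+ v) := x :+ γ :* u :+ (y :+ γ :* v))
        refl x y (- c) (hi f) (hi g))
    hi-+ []      g       = sym (+-identityˡ _)
    hi-+ (x ∷ f) []      = sym (+-identityʳ _)
    hi-+ (x ∷ f) (y ∷ g) = trans (+-cong (*-congˡ (hi-+ f g)) (lo-+ f g))
      (solve 5 (λ β u v s t → β :* (u :+ v) :+ (s :+ t) := β :* u :+ s :+ (β :* v :+ t))
        refl (- b) (hi f) (hi g) (lo f) (lo g))

    lo-scale : ∀ k f → lo (map (k *_) f) ≈ k * lo f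
    hi-scale : ∀ k f → hi (map (k *_) f) ≈ k * hi f
    lo-scale k []      = sym (zeroʳ k)
    lo-scale k (x ∷ f) = trans (+-congˡ (*-congˡ (hi-scale k f)))
      (solve 4 (λ k x γ u → k :* x :+ γ :* (k :* u) := k :* (x :+ γ :* u))
        refl k x (- c) (hi f))
    hi-scale k []      = sym (zeroʳ k)
    hi-scale k (x ∷ f) = trans (+-cong (*-congˡ (hi-scale k f)) (lo-scale k f))
      (solve 4 (λ k β u s → β :* (k :* u) :+ k :* s := k :* (β :* u :+ s))
        refl k (- b) (hi f) (lo f))

    vanishes-∷ : ∀ {x g} → x ≈ 0# → Vanishes g → Vanishes (x ∷ g)
    vanishes-∷ {x} {g} x≈0 (lo≈0 , hi≈0) =
      trans (+-cong x≈0 (*-congˡ hi≈0)) (trans (+-identityˡ _) (zeroʳ _)) ,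
      trans (+-cong (*-congˡ hi≈0) lo≈0) (trans (+-identityʳ _) (zeroʳ _))

    vanishes-≈[] : ∀ {g} → g ≈ₚ [] → Vanishes g
    vanishes-≈[] {[]}    g≈[] = refl , refl
    vanishes-≈[] {x ∷ g} g≈[] =
      vanishes-∷ (g≈[] 0) (vanishes-≈[] {g} (λ n → g≈[] (suc n)))

    -- Equal polynomials may be lists of different lengths. When one list runs out, the other
    -- represents zero and `vanishes-≈[]` applies.
    lo-cong : ∀ {f g} → f ≈ₚ g → lo f ≈ lo g
    hi-cong : ∀ {f g} → f ≈ₚ g → hi f ≈ hi g
    lo-cong {[]}    {g}     f≈g = sym (lo≈0 (vanishes-≈[] {g} (λ n → sym (f≈g n))))
    lo-cong {x ∷ f} {[]}    f≈g = lo≈0 (vanishes-≈[] {x ∷ f} f≈g)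
    lo-cong {x ∷ f} {y ∷ g} f≈g =
      +-cong (f≈g 0) (*-congˡ (hi-cong {f} {g} (λ n → f≈g (suc n))))
    hi-cong {[]}    {g}     f≈g = sym (hi≈0 (vanishes-≈[] {g} (λ n → sym (f≈g n))))
    hi-cong {x ∷ f} {[]}    f≈g = hi≈0 (vanishes-≈[] {x ∷ f} f≈g)
    hi-cong {x ∷ f} {y ∷ g} f≈g =
      +-cong (*-congˡ (hi-cong {f} {g} λ n → f≈g (suc n)))
             (lo-cong {f} {g} λ n → f≈g (suc n))

    vanishes-cong : ∀ {f g} → f ≈ₚ g → Vanishes f → Vanishes g
    vanishes-cong {f} {g} f≈g (lo≈0 , hi≈0) =
      trans (sym (lo-cong {f} {g} f≈g)) lo≈0 , trans (sym (hi-cong {f} {g} f≈g)) hi≈0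

    vanishes-+ : ∀ {f g} → Vanishes f → Vanishes g → Vanishes (f +ₚ g)
    vanishes-+ {f} {g} (lof≈0 , hif≈0) (log≈0 , hig≈0) =
      trans (lo-+ f g) (trans (+-cong lof≈0 log≈0) (+-identityˡ 0#)) ,
      trans (hi-+ f g) (trans (+-cong hif≈0 hig≈0) (+-identityˡ 0#))

    vanishes-scale : ∀ k {f} → Vanishes f → Vanishes (map (k *_) f)
    vanishes-scale k {f} (lo≈0 , hi≈0) =
      trans (lo-scale k f) (trans (*-congˡ lo≈0) (zeroʳ k)) ,
      trans (hi-scale k f) (trans (*-congˡ hi≈0) (zeroʳ k))

    -- The product unfolds to `x f + X (q f)`, and `vanishes-∷` with head zero is closure under
    -- multiplication by `X`.
    vanishes-* : ∀ q {f} → Vanishes f → Vanishes (q *ₚ f)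
    vanishes-* []      vf = refl , refl
    vanishes-* (x ∷ q) {f} vf =
      vanishes-+ {map (x *_) f} (vanishes-scale x vf) (vanishes-∷ refl (vanishes-* q vf))

    -- Induction on `q` through `X (x g + X q g) = x (X g) + X (X q g)`. It serves to show that
    -- `X + b` is not a unit when `c ≈ 0#`.
    vanishes-0∷-* : ∀ q {g} → Vanishes (0# ∷ g) → Vanishes (0# ∷ (q *ₚ g))
    vanishes-0∷-* []      vXg = vanishes-∷ {g = []} refl (refl , refl)
    vanishes-0∷-* (x ∷ q) {g} vXg = vanishes-cong
      {map (x *_) (0# ∷ g) +ₚ (0# ∷ 0# ∷ (q *ₚ g))}
      -- The heads differ, `x * 0# + 0#` against `0#`, while the tails agree by computation.
      (∷-cong (trans (+-identityʳ _) (zeroʳ x)) λ n → refl)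
      (vanishes-+ {map (x *_) (0# ∷ g)} (vanishes-scale x {0# ∷ g} vXg)
        (vanishes-∷ refl (vanishes-0∷-* q vXg)))

    -- Remainders of constants, linear polynomials and the quadratic

    hi-const : ∀ x → hi (const x) ≈ 0#
    hi-const x = trans (+-identityʳ _) (zeroʳ _)

    lo-const : ∀ x → lo (const x) ≈ x
    lo-const x = trans (+-congˡ (zeroʳ _)) (+-identityʳ x)

    hi-linear : ∀ x y → hi (x ∷ y ∷ []) ≈ y
    hi-linear x y = trans (+-cong (trans (*-congˡ (hi-const y)) (zeroʳ _)) (lo-const y))
                          (+-identityˡ y)

    lo-linear : ∀ x y → lo (x ∷ y ∷ []) ≈ x
    lo-linear x y = trans (+-congˡ (trans (*-congˡ (hi-const y)) (zeroʳ _))) (+-identityʳ x)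

    -- The tail `b + X` is its own remainder, so the last Horner step yields `c - c` and `- b + b`.
    quadratic-vanishes : Vanishes quadratic
    quadratic-vanishes =
      trans (+-congˡ (trans (*-congˡ (hi-linear b 1#)) (*-identityʳ _))) (-‿inverseʳ c) ,
      trans (+-cong (trans (*-congˡ (hi-linear b 1#)) (*-identityʳ _)) (lo-linear b 1#))
            (-‿inverseˡ b)

    -- If c = 0 then f = X (X + b), but neither factor is a unit.
    irreducible⇒c≉0 : ∀ {f} → f ≈ₚ quadratic → Irreducible f → ¬ c ≈ 0#
    irreducible⇒c≉0 {f} f≈quadratic irr c≈0 =
      [ X∤1 , X+b∤1 ]′ (RawSemiringDefinitions.Irreducible.split-∣1 irr {X} {X+b} f≈X*[X+b])
      where
      X+b : Poly
      X+b = b ∷ 1# ∷ []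

      quadratic≈ : quadratic ≈ₚ 0# ∷ X+b
      quadratic≈ = ∷-cong c≈0 λ n → refl

      f≈X*[X+b] : f ≈ₚ X *ₚ X+b
      f≈X*[X+b] n =
        trans (f≈quadratic n) (trans (quadratic≈ n) (sym (X*≈ X+b n)))

      -- From `q (X + b) ≈ 1` it would follow that `X ≈ X q (X + b)`. This vanishes because
      -- `X (X + b)` is the quadratic, yet `hi X` is `1#`.
      X+b∤1 : ¬ X+b ∣ₚ const 1#
      X+b∤1 (q , q[X+b]≈1) = 1≉0 (trans (sym (hi-linear 0# 1#)) (hi≈0 X-vanishes))
        where
        X-vanishes : Vanishes X
        X-vanishes = vanishes-cong {0# ∷ (q *ₚ X+b)} (∷-cong refl q[X+b]≈1)
          (vanishes-0∷-* q {X+b} (vanishes-cong {quadratic} quadratic≈ quadratic-vanishes))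

    -- Powers of `X` and the Lucas sequence

    lo-X^ : ∀ n → lo (X ^ₚ suc n) ≈ - (c * lucasU b c n)
    -- In the mutual induction, the Horner clause for `hi` at `X ^ₚ (n + 2)` is the Lucas recurrence
    -- itself. The formula for `lo` starts at exponent one, since at exponent zero it would need a
    -- term before `U 0`.
    hi-X^ : ∀ n → hi (X ^ₚ n) ≈ lucasU b c n
    lo-X^ n = begin
      lo (X *ₚ X ^ₚ n)             ≈⟨ lo-cong {X *ₚ X ^ₚ n} {0# ∷ X ^ₚ n} (X*≈ (X ^ₚ n)) ⟩
      0# + - c * hi (X ^ₚ n)       ≈⟨ +-identityˡ _ ⟩
      - c * hi (X ^ₚ n)            ≈⟨ *-congˡ (hi-X^ n) ⟩
      - c * lucasU b c n           ≈⟨ -‿distribˡ-* c (lucasU b c n) ⟨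
      - (c * lucasU b c n)         ∎
    hi-X^ zero          = hi-const 1#
    hi-X^ (suc zero)    = trans (hi-cong {X ^ₚ 1} {X} (X*≈ (const 1#))) (hi-linear 0# 1#)
    hi-X^ (suc (suc n)) = trans (hi-cong {X *ₚ X ^ₚ suc n} {0# ∷ X ^ₚ suc n} (X*≈ (X ^ₚ suc n)))
      (+-cong (*-congˡ (hi-X^ (suc n))) (lo-X^ n))

    -- Division with remainder by the quadratic

    quot : Poly → Poly
    quot []      = []
    quot (x ∷ g) = hi g ∷ quot g

    -- If `g = Q f + lo g + hi g X`, then the term `hi g X²` of `x + X g` is `hi g (f - b X - c)`.
    -- So `hi g` is the next quotient coefficient, and the rest is the new remainder.
    quot-*-+ : ∀ {f} → f ≈ₚ quadratic → ∀ g n →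
               coeff (quot g *ₚ f) n + coeff (lo g ∷ hi g ∷ []) n ≈ coeff g n
    quot-*-+ f≈ []      zero          = +-identityˡ _
    quot-*-+ f≈ []      (suc zero)    = +-identityˡ _
    quot-*-+ f≈ []      (suc (suc n)) = +-identityˡ _
    quot-*-+ {f} f≈ (x ∷ g) n = trans (+-congʳ expand) (step n)
      where
      k = hi g
      qf = quot g *ₚ f

      expand : coeff (map (k *_) f +ₚ (0# ∷ qf)) n ≈ k * coeff quadratic n + coeff (0# ∷ qf) n
      expand = trans (coeff-+ (map (k *_) f) (0# ∷ qf) n)
                     (+-congʳ (trans (coeff-scale k f n) (*-congˡ (f≈ n))))

      step : ∀ n → k * coeff quadratic n + coeff (0# ∷ qf) n +
                   coeff (lo (x ∷ g) ∷ hi (x ∷ g) ∷ []) n ≈ coeff (x ∷ g) n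
      step 0 = begin
        k * c + 0# + (x + - c * k)   ≈⟨ solve 4 (λ k c γ x → k :* c :+ con 0 :+ (x :+ γ :* k) := k :* (c :+ γ) :+ x) refl k c (- c) x ⟩
        k * (c + - c) + x            ≈⟨ +-congʳ (trans (*-congˡ (-‿inverseʳ c)) (zeroʳ k)) ⟩
        0# + x                       ≈⟨ +-identityˡ x ⟩
        x                            ∎
      step 1 = begin
        k * b + coeff qf 0 + (- b * k + lo g)
          ≈⟨ solve 5 (λ k b β u v → k :* b :+ u :+ (β :* k :+ v) := k :* (b :+ β) :+ (u :+ v)) refl k b (- b) (coeff qf 0) (lo g) ⟩
        k * (b + - b) + (coeff qf 0 + lo g)
          ≈⟨ +-cong (trans (*-congˡ (-‿inverseʳ b)) (zeroʳ k)) (quot-*-+ {f} f≈ g 0) ⟩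
        0# + coeff g 0
          ≈⟨ +-identityˡ _ ⟩
        coeff g 0
          ∎
      -- The leading coefficient of the quadratic contributes `k`, which is the degree-one remainder
      -- coefficient in the induction hypothesis for `g`.
      step 2 = trans
        (solve 2 (λ k u → k :* con 1 :+ u :+ con 0 := u :+ k) refl k (coeff qf 1))
        (quot-*-+ {f} f≈ g 1)
      step (suc (suc (suc n))) = trans
        (solve 2 (λ k u → k :* con 0 :+ u :+ con 0 := u :+ con 0) refl k (coeff qf (suc (suc n))))
        (quot-*-+ {f} f≈ g (suc (suc n)))

    vanishes⇒∣ : ∀ {f} → f ≈ₚ quadratic → ∀ {g} → Vanishes g → f ∣ₚ g
    vanishes⇒∣ {f} f≈ {g} (lo≈0 , hi≈0) = quot g , λ n → begin
      coeff (quot g *ₚ f) n                                   ≈⟨ +-identityʳ _ ⟨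
      coeff (quot g *ₚ f) n + 0#                              ≈⟨ +-congˡ (rem≈0 n) ⟨
      coeff (quot g *ₚ f) n + coeff (lo g ∷ hi g ∷ []) n      ≈⟨ quot-*-+ {f} f≈ g n ⟩
      coeff g n                                               ∎
      where
      rem≈0 : lo g ∷ hi g ∷ [] ≈ₚ []
      rem≈0 zero          = lo≈0
      rem≈0 (suc zero)    = hi≈0
      rem≈0 (suc (suc n)) = refl

    ∣⇒vanishes : ∀ {f} → f ≈ₚ quadratic → ∀ {g} → f ∣ₚ g → Vanishes g
    ∣⇒vanishes {f} f≈ (q , qf≈g) = vanishes-cong {q *ₚ f} qf≈g
      (vanishes-* q (vanishes-cong {quadratic} {f} (λ n → sym (f≈ n)) quadratic-vanishes))

    -- Binomials divisible by the quadratic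

    lo-X^+const : ∀ n x → lo (X ^ₚ suc n +ₚ const x) ≈ - (c * lucasU b c n) + x
    lo-X^+const n x = trans (lo-+ (X ^ₚ suc n) (const x)) (+-cong (lo-X^ n) (lo-const x))

    hi-X^+const : ∀ n x → hi (X ^ₚ n +ₚ const x) ≈ lucasU b c n
    hi-X^+const n x = trans (hi-+ (X ^ₚ n) (const x))
      (trans (+-cong (hi-X^ n) (hi-const x)) (+-identityʳ _))

    minimalBinomialMultiple :
      ∀ {f} → f ≈ₚ quadratic → Irreducible f →
      ∀ r → IsLeast (λ n → 1 ≤ n × lucasU b c n ≈ 0#) r →
      IsMinimalBinomialMultipleOfDegree f r (X ^ₚ r +ₚ const (c * lucasU b c (r ∸ 1)))
    minimalBinomialMultiple f≈ irr zero ((() , _) , _)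
    minimalBinomialMultiple {f} f≈ irr (suc m) ((_ , Uᵣ≈0) , least) = record
      -- A binomial is written with a minus sign, so the constant `+ d` corresponds to the witness
      -- `- d`.
      { binomial = s≤s z≤n , - d , -d≉0 ,
          +ₚ-const-cong (X ^ₚ suc m) (sym (-‿involutive d))
      ; multiple = vanishes⇒∣ {f} f≈
          ( trans (lo-X^+const m d) (-‿inverseˡ d)
          , trans (hi-X^+const (suc m) d) Uᵣ≈0)
      -- The subtracted constant reduces to adding `const (- x)`, so the `hi` part of the remainder
      -- is `U s`. Divisibility makes it zero, and leastness of `r` applies.
      ; minimal  = λ { s h (1≤s , x , _ , h≈) f∣h → least s (1≤s ,
          trans (sym (hi-X^+const s (- x)))
                (hi≈0 (vanishes-cong {h} {X ^ₚ s -ₚ const x} h≈ (∣⇒vanishes {f} f≈ {h} f∣h)))) }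
      ; unique   = λ { h (_ , x , _ , h≈) f∣h → λ n →
          trans (h≈ n) (+ₚ-const-cong (X ^ₚ suc m) (-x≈d {h} h≈ f∣h) n) }
      }
      where
      d = c * lucasU b c m

      -- For `m = 0` the term `U 0` is zero, so the contradiction comes from `U 1 = 1`. For positive
      -- `m` a zero at `m` would contradict leastness.
      Uₘ≉0 : ∀ m → (∀ n → 1 ≤ n × lucasU b c n ≈ 0# → suc m ≤ n) →
             lucasU b c (suc m) ≈ 0# → ¬ lucasU b c m ≈ 0#
      Uₘ≉0 zero    least U₁≈0 _    = 1≉0 U₁≈0
      Uₘ≉0 (suc m) least _    U≈0  = 1+n≰n (least (suc m) (s≤s z≤n , U≈0))

      -d≉0 : ¬ - d ≈ 0#
      -d≉0 -d≈0 = *-≉0 (irreducible⇒c≉0 {f} f≈ irr) (Uₘ≉0 m least Uᵣ≈0)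
        (trans (sym (-‿involutive d)) (trans (-‿cong -d≈0) -0#≈0#))

      -- The `lo` part of the remainder is `- d + - x`. Its vanishing determines the constant term.
      -x≈d : ∀ {h x} → h ≈ₚ X ^ₚ suc m -ₚ const x → f ∣ₚ h → - x ≈ d
      -x≈d {h} {x} h≈ f∣h = trans
        (+-inverseʳ-unique (- d) (- x) (trans (sym (lo-X^+const m (- x)))
          (lo≈0 (vanishes-cong {h} {X ^ₚ suc m -ₚ const x} h≈ (∣⇒vanishes {f} f≈ {h} f∣h)))))
        (-‿involutive d)

corollary3p15 :
    ∀ {a ℓ₁ ℓ₂ : Level} (q : ℕ) → IsPrimePower q →
    (F : HeytingField a ℓ₁ ℓ₂) → HasOrder F q →
    let open HeytingField F
        open Polynomials F
    in
    (b c : Carrier) →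
    let f = X ^ₚ 2 +ₚ const b *ₚ X +ₚ const c
        U = lucasU b c
    in
    Irreducible f →
    (r : ℕ) → IsLeast (λ n → 1 ≤ n × U n ≈ 0#) r →
    IsBinomialOrder f r ×
    IsMinimalBinomialMultiple f (X ^ₚ r +ₚ const (c * U (r ∸ 1)))
corollary3p15 q _ F _ b c irr r least = (_ , minimal) , (r , minimal)
  where
  open Polynomials F
  open PolynomialLemmas F
  open MonicQuadratic b c
  minimal = minimalBinomialMultiple {X ^ₚ 2 +ₚ const b *ₚ X +ₚ const c} X²+bX+c≈quadratic irr r least
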